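{- Let $S$ be a set of $k\ge2$ nonempty binary strings such that the Seeker wins the Renyi-Ulam game with lie restriction $r(S)$. Then the shortest string in $S$ has length at most $4k-4$.
   Context: For a set $S$ of nonempty binary strings, $r(S)$ is the set of all finite binary strings that contain no element of $S$ as a contiguous substring. Renyi-Ulam game with lie restriction $R$: the Obscurer picks $x\in\{1,\dots,n\}$; on each turn the Seeker asks whether $x$ lies in a chosen subset and the Obscurer answers yes or no. For a candidate $y$, its lie pattern is the binary string whose $i$-th bit is $1$ iff the $i$-th answer is false for $y$. The Obscurer's answers must keep the lie pattern of her number in $R$ after every answer. The Seeker wins for $n$ if he has an adaptive strategy which after finitely many questions guarantees that at most one $y\in\{1,\dots,n\}$ has its lie pattern in $R$. "The Seeker wins" means he wins for every $n\ge1$. -}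

module Defs where

open import Data.Bool using (Bool; true; false; _xor_)
open import Data.Nat using (ℕ; _≤_)
open import Data.Fin using (Fin)
open import Data.Fin.Subset using (Subset)
open import Data.Vec using (lookup)
open import Data.List using (List; []; _∷_; _++_; [_])
open import Data.List.Membership.Propositional using (_∈_)
open import Data.Product using (∃₂)
open import Relation.Binary.PropositionalEquality using (_≡_)
open import Relation.Nullary using (¬_)

BinStr : Set
BinStr = List Bool

_⊑_ : BinStr → BinStr → Set
u ⊑ w = ∃₂ λ xs ys → xs ++ u ++ ys ≡ w

r : List BinStr → BinStr → Set
r S w = ∀ {s} → s ∈ S → ¬ (s ⊑ w)

-- Lie bit for candidate y when the question is Q and the answer is a
-- (a = true means "yes"): 1 iff the answer is false for y,
-- i.e. iff (y ∈ Q) differs from a.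
lieBit : ∀ {n} → Subset n → Bool → Fin n → Bool
lieBit Q a y = lookup Q y xor a

-- SeekerWins R n pat : from the position where candidate y has lie
-- pattern (pat y), the Seeker has a strategy that after finitely many
-- questions (inductive = well-founded strategy tree) guarantees that at
-- most one candidate has its lie pattern in R, whatever the answers.
-- (Answers leaving no candidate with pattern in R are illegal for the
--  Obscurer; they lead to a trivially won position anyway.)
data SeekerWins (R : BinStr → Set) (n : ℕ) : (Fin n → BinStr) → Set where
  done : ∀ {pat} → (∀ y z → R (pat y) → R (pat z) → y ≡ z) → SeekerWins R n pat
  ask  : ∀ {pat} (Q : Subset n) →
         (∀ (a : Bool) → SeekerWins R n (λ y → pat y ++ [ lieBit Q a y ])) →
         SeekerWins R n pat

SeekerWinsFor : (BinStr → Set) → ℕ → Set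
SeekerWinsFor R n = SeekerWins R n (λ _ → [])

SeekerWinsGame : (BinStr → Set) → Set
SeekerWinsGame R = ∀ n → 1 ≤ n → SeekerWinsFor R n

{-# OPTIONS --safe #-}
-- Two candidates suffice for the Obscurer when all strings of S are longer than 4k − 4; we may cut
-- them down to their prefixes of length L = 4k − 3.  On each turn the Seeker only decides whether
-- the two new lie bits are equal, and the Obscurer then picks one of the two possibilities.
--
-- For k ≥ 3, give a partially matched string with m symbols still to come the weight (2/3)^m.
-- Going over both answers, every partial match survives exactly once, so one of the answers
-- multiplies the total weight by at most 3/4; the total stays below 1, where 1 would be a full match.
--
-- For k = 2 (L = 5) the potential is too weak.  Here the Obscurer chooses the bits of the two
-- candidates in alternation, so on each pattern she controls every other bit.  One of six simple
-- strategies for this one-pattern game avoids any two given strings of length 5.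
module Submission where

open import Defs
open import Data.Nat using (ℕ; _≤_; _*_; _∸_)
open import Data.List using (List; []; length)
open import Data.List.Relation.Unary.All using (All)
open import Data.List.Relation.Unary.Any using (Any)
open import Data.List.Relation.Unary.Unique.Propositional using (Unique)
open import Relation.Binary.PropositionalEquality using (_≡_; _≢_)

open import Data.Bool using (Bool; true; false; T; not; _∧_; _∨_; _xor_)
import Data.Bool.Properties as Bool
open import Data.Bool.Properties using (T?)
open import Data.Fin.Patterns using (0F; 1F)
open import Data.List using (_∷_; _++_; _∷ʳ_; [_]; foldl; map; initLast; _∷ʳ′_)
open import Data.List.Membership.Propositional using (_∈_; _∉_)
open import Data.List.Membership.Propositional.Properties using (∈-++⁺ˡ; ∈-++⁺ʳ; ∈-map⁻)
open import Data.List.Properties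
  using (++-assoc; ++-identityʳ; ++-conicalˡ; ++-conicalʳ; ∷ʳ-injectiveˡ; foldl-++; foldl-∷ʳ)
import Data.List.Relation.Unary.All as All
open import Data.List.Relation.Unary.All using ([]; _∷_; all?)
open import Data.List.Relation.Unary.Any using (here; there; any?)
open import Data.List.Relation.Unary.All.Properties using (¬Any⇒All¬)
open import Data.Nat using (zero; suc; _+_; _^_; _<_; z≤n; s≤s)
open import Data.Nat.ListAction using (sum)
open import Data.Nat.Properties
open import Data.Nat.Tactic.RingSolver using (solve-∀)
open import Data.Product using (∃; _×_; _,_; proj₁; proj₂)
open import Data.Sum using (_⊎_; inj₁; inj₂)
open import Data.Vec using (Vec; []; _∷_; toList; lookup)
import Data.Vec as Vec
import Data.Vec.Properties as Vec
open import Function using (_∘_)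
open import Relation.Nullary using (¬_; Dec; yes; no; contradiction)
open import Relation.Nullary.Decidable using (map′; _×-dec_; _→-dec_; ¬?; toWitness)
open import Relation.Binary.PropositionalEquality using (refl; sym; trans; cong; cong₂; subst; subst₂)

-- Two candidates and an automaton invariant.

SeekerWins-antitone : ∀ {R R′ n pat} → (∀ {w} → R′ w → R w) →
                      SeekerWins R n pat → SeekerWins R′ n pat
SeekerWins-antitone R′⊆R (done unique) = done λ y z Ry Rz → unique y z (R′⊆R Ry) (R′⊆R Rz)
SeekerWins-antitone R′⊆R (ask Q win)   = ask Q λ a → SeekerWins-antitone R′⊆R (win a)

-- δ is an automaton reading lie patterns that is in a state satisfying Acc whenever the input
-- ends in a string of S.
module TwoCandidates {A : Set} (δ : A → Bool → A) (S : List BinStr) (Acc : A → Set)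
  (detects : ∀ {s} a → s ∈ S → Acc (foldl δ a s)) (P : A → A → Set)
  (safe : ∀ {a b} → P a b → ¬ Acc a × ¬ Acc b)
  (answer : ∀ {a b} → P a b → ∀ p q → ∃ λ c → P (δ a (p xor c)) (δ b (q xor c)))
  where

  r-[] : ∀ {a} → ¬ Acc a → r S []
  r-[] {a} ¬acc {s} s∈S (xs , ys , eq) = ¬acc (subst (Acc ∘ foldl δ a) s≡[] (detects a s∈S))
    where s≡[] = ++-conicalˡ s ys (++-conicalʳ xs (s ++ ys) eq)

  -- A new occurrence ends at the last symbol, where `detects` applies whatever state its first
  -- symbol met; any other occurrence already lies in `u`.
  r-∷ʳ : ∀ {a u x} → r S u → ¬ Acc (foldl δ a (u ∷ʳ x)) → r S (u ∷ʳ x)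
  r-∷ʳ {a} {u} {x} ru ¬acc {s} s∈S (xs , ys , eq) with initLast ys
  ... | [] = ¬acc (subst Acc ends (detects (foldl δ a xs) s∈S))
    where
    ends : foldl δ (foldl δ a xs) s ≡ foldl δ a (u ∷ʳ x)
    ends = trans (sym (foldl-++ δ a xs s))
                 (cong (foldl δ a) (trans (cong (xs ++_) (sym (++-identityʳ s))) eq))
  ... | ys′ ∷ʳ′ y = ru s∈S (xs , ys′ , ∷ʳ-injectiveˡ _ _ (trans regroup eq))
    where
    regroup : (xs ++ s ++ ys′) ∷ʳ y ≡ xs ++ s ++ ys′ ∷ʳ y
    regroup = trans (++-assoc xs (s ++ ys′) [ y ]) (cong (xs ++_) (++-assoc s ys′ [ y ]))

  -- Induction on the Seeker's tree: `answer` maintains `P`, and at a leaf both candidates are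
  -- alive. The initial states are free because `detects` holds from every state.
  survive : ∀ {a b pat} → r S (pat 0F) → r S (pat 1F) →
            P (foldl δ a (pat 0F)) (foldl δ b (pat 1F)) → ¬ SeekerWins (r S) 2 pat
  survive r₀ r₁ p (done unique) with () ← unique 0F 1F r₀ r₁
  survive {a} {b} {pat} r₀ r₁ p (ask Q win) with answer p (lookup Q 0F) (lookup Q 1F)
  ... | c , p′ = survive (r-∷ʳ r₀ (proj₁ (safe p″))) (r-∷ʳ r₁ (proj₂ (safe p″))) p″ (win c)
    where
    p″ : P (foldl δ a (pat 0F ∷ʳ lieBit Q c 0F)) (foldl δ b (pat 1F ∷ʳ lieBit Q c 1F))
    p″ = subst₂ P (sym (foldl-∷ʳ δ a _ (pat 0F))) (sym (foldl-∷ʳ δ b _ (pat 1F))) p′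

  obscurer-wins : ∀ {a b} → P a b → ¬ SeekerWinsFor (r S) 2
  obscurer-wins p = survive (r-[] (proj₁ (safe p))) (r-[] (proj₂ (safe p))) p

-- The potential argument

-- A list of strings stands for the unread parts of the partially matched strings.
residuals : Bool → List BinStr → List BinStr
residuals x     []                = []
residuals x     ([] ∷ U)          = residuals x U
residuals false ((false ∷ u) ∷ U) = u ∷ residuals false U
residuals false ((true  ∷ u) ∷ U) = residuals false U
residuals true  ((false ∷ u) ∷ U) = residuals true U
residuals true  ((true  ∷ u) ∷ U) = u ∷ residuals true U

residuals-∈ : ∀ {x u} U → x ∷ u ∈ U → u ∈ residuals x U
residuals-∈ {false} (_ ∷ U)           (here refl) = here refl
residuals-∈ {true}  (_ ∷ U)           (here refl) = here refl
residuals-∈ {x}     ([] ∷ U)          (there u∈U) = residuals-∈ U u∈U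
residuals-∈ {false} ((false ∷ _) ∷ U) (there u∈U) = there (residuals-∈ U u∈U)
residuals-∈ {false} ((true  ∷ _) ∷ U) (there u∈U) = residuals-∈ U u∈U
residuals-∈ {true}  ((false ∷ _) ∷ U) (there u∈U) = residuals-∈ U u∈U
residuals-∈ {true}  ((true  ∷ _) ∷ U) (there u∈U) = there (residuals-∈ U u∈U)

module _ (S : List BinStr) where

  -- A match may begin at any symbol, so all of `S` joins the state before each reading; `[]` marks
  -- a completed match.
  advance : List BinStr → Bool → List BinStr
  advance U x = residuals x (S ++ U)

  advance-∈ : ∀ {U} u → u ∈ U → [] ∈ foldl advance U u
  advance-∈     []      u∈U = u∈U
  advance-∈ {U} (x ∷ u) u∈U = advance-∈ u (residuals-∈ (S ++ U) (∈-++⁺ʳ S u∈U))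

  advance-detects : [] ∉ S → ∀ {s} U → s ∈ S → [] ∈ foldl advance U s
  advance-detects []∉S {[]}    U s∈S = contradiction s∈S []∉S
  advance-detects []∉S {x ∷ s} U s∈S = advance-∈ s (residuals-∈ (S ++ U) (∈-++⁺ˡ s∈S))

-- The weight (2/3)^|u|, scaled by 3^L to be integral for |u| ≤ L.
module Potential (L : ℕ) where

  weight : BinStr → ℕ
  weight u = 2 ^ length u * 3 ^ (L ∸ length u)

  potential : List BinStr → ℕ
  potential U = sum (map weight U)

  -- For `l ≤ m` truncated subtraction makes this 1 ≤ 3; otherwise it is an equality.
  3^-step : ∀ l m → 3 ^ (l ∸ m) ≤ 3 * 3 ^ (l ∸ suc m)
  3^-step l m = ^-monoʳ-≤ 3 (begin
    l ∸ m           ≤⟨ m≤n+m∸n (l ∸ m) 1 ⟩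
    1 + (l ∸ m ∸ 1) ≡⟨ cong suc (trans (∸-+-assoc l m 1) (cong (l ∸_) (+-comm m 1))) ⟩
    suc (l ∸ suc m) ∎)
    where open ≤-Reasoning

  weight-∷ : ∀ x u → 2 * weight u ≤ 3 * weight (x ∷ u)
  weight-∷ x u = begin
    2 * (2 ^ m * 3 ^ (L ∸ m))           ≤⟨ *-monoʳ-≤ 2 (*-monoʳ-≤ (2 ^ m) (3^-step L m)) ⟩
    2 * (2 ^ m * (3 * 3 ^ (L ∸ suc m))) ≡⟨ rearrange (2 ^ m) (3 ^ (L ∸ suc m)) ⟩
    3 * (2 ^ suc m * 3 ^ (L ∸ suc m))   ∎
    where
    open ≤-Reasoning
    m = length u
    rearrange : ∀ a b → 2 * (a * (3 * b)) ≡ 3 * (2 * a * b)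
    rearrange = solve-∀

  potential-++ : ∀ U V → potential (U ++ V) ≡ potential U + potential V
  potential-++ []      V = refl
  potential-++ (u ∷ U) V = trans (cong (weight u +_) (potential-++ U V)) (sym (+-assoc (weight u) _ _))

  -- Each nonempty string survives under exactly one bit, its weight growing by a factor of at most
  -- 3/2; a completed match disappears.
  potential-residuals : ∀ U →
    2 * (potential (residuals false U) + potential (residuals true U)) ≤ 3 * potential U
  potential-residuals []       = z≤n
  potential-residuals ([] ∷ U) =
    ≤-trans (potential-residuals U) (*-monoʳ-≤ 3 (m≤n+m (potential U) (weight [])))
  potential-residuals ((x ∷ u) ∷ U) = begin
    2 * (potential (residuals false ((x ∷ u) ∷ U)) + potential (residuals true ((x ∷ u) ∷ U)))
      ≡⟨ cong (2 *_) (split x) ⟩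
    2 * (weight u + rest)                    ≡⟨ *-distribˡ-+ 2 (weight u) rest ⟩
    2 * weight u + 2 * rest                  ≤⟨ +-mono-≤ (weight-∷ x u) (potential-residuals U) ⟩
    3 * weight (x ∷ u) + 3 * potential U     ≡⟨ *-distribˡ-+ 3 (weight (x ∷ u)) (potential U) ⟨
    3 * (weight (x ∷ u) + potential U)       ∎
    where
    open ≤-Reasoning
    f = potential (residuals false U)
    t = potential (residuals true U)
    rest = f + t
    swap : ∀ a b c → a + (b + c) ≡ b + (a + c)
    swap = solve-∀
    split : ∀ x → potential (residuals false ((x ∷ u) ∷ U)) + potential (residuals true ((x ∷ u) ∷ U))
                  ≡ weight u + rest
    split false = +-assoc (weight u) f t
    split true  = swap f (weight u) t

  -- `[]` alone weighs `3 ^ L`.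
  potential-∌[] : ∀ {U} → potential U < 3 ^ L → [] ∉ U
  potential-∌[] {_ ∷ U} bound (here refl) =
    <⇒≱ bound (≤-trans (≤-reflexive (sym (*-identityˡ (3 ^ L)))) (m≤m+n (weight []) (potential U)))
  potential-∌[] {u ∷ U} bound (there []∈U) =
    potential-∌[] (≤-<-trans (m≤n+m (potential U) (weight u)) bound) []∈U

  module _ (S : List BinStr) where

    -- The bound 6 Φ(S) is the fixed point of B ↦ 3/4 (B + 2 Φ(S)).
    Light : List BinStr → List BinStr → Set
    Light U V = potential U + potential V ≤ 6 * potential S

    -- With `S` joined to both states the potential is at most 8 Φ(S); the factor 3/2 makes this 12
    -- Φ(S), shared by two answers.
    average-bound : ∀ {U V} → Light U V →
      (potential (advance S U false) + potential (advance S U true)) +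
      (potential (advance S V false) + potential (advance S V true)) ≤ 2 * (6 * potential S)
    average-bound {U} {V} light = *-cancelˡ-≤ 2 (begin
      2 * (u + v)                                ≡⟨ *-distribˡ-+ 2 u v ⟩
      2 * u + 2 * v
        ≤⟨ +-mono-≤ (potential-residuals (S ++ U)) (potential-residuals (S ++ V)) ⟩
      3 * potential (S ++ U) + 3 * potential (S ++ V)
        ≡⟨ cong₂ (λ a b → 3 * a + 3 * b) (potential-++ S U) (potential-++ S V) ⟩
      3 * (s + potential U) + 3 * (s + potential V) ≡⟨ collect s (potential U) (potential V) ⟩
      6 * s + 3 * (potential U + potential V)    ≤⟨ +-monoʳ-≤ (6 * s) (*-monoʳ-≤ 3 light) ⟩
      6 * s + 3 * (6 * s)                        ≡⟨ total s ⟩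
      2 * (2 * (6 * s))                          ∎)
      where
      open ≤-Reasoning
      s = potential S
      u = potential (advance S U false) + potential (advance S U true)
      v = potential (advance S V false) + potential (advance S V true)
      collect : ∀ a b c → 3 * (a + b) + 3 * (a + c) ≡ 6 * a + 3 * (b + c)
      collect = solve-∀
      total : ∀ a → 6 * a + 3 * (6 * a) ≡ 2 * (2 * (6 * a))
      total = solve-∀

    -- The two answers give each candidate opposite bits, so they split the four terms of
    -- `average-bound` into two pairs; the lighter pair has at most half the total.
    light-answer : ∀ {U V} → Light U V → ∀ p q →
                   ∃ λ c → Light (advance S U (p xor c)) (advance S V (q xor c))
    light-answer {U} {V} light p q =
        choose (subst (_≤ 2 * (6 * potential S)) (pairing p q) (average-bound {U} {V} light))
      where
      f : Bool → ℕ
      f = potential ∘ advance S U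
      g : Bool → ℕ
      g = potential ∘ advance S V

      exchange₁ : ∀ a b c d → (a + b) + (c + d) ≡ (a + c) + (b + d)
      exchange₁ = solve-∀
      exchange₂ : ∀ a b c d → (a + b) + (c + d) ≡ (a + d) + (b + c)
      exchange₂ = solve-∀

      pairing : ∀ p q → (f false + f true) + (g false + g true) ≡
                (f (p xor false) + g (q xor false)) + (f (p xor true) + g (q xor true))
      pairing false false = exchange₁ (f false) (f true) (g false) (g true)
      pairing false true  = exchange₂ (f false) (f true) (g false) (g true)
      pairing true  false = trans (exchange₂ (f false) (f true) (g false) (g true)) (+-comm (f false + g true) _)
      pairing true  true  = trans (exchange₁ (f false) (f true) (g false) (g true)) (+-comm (f false + g false) _)

      choose : ∀ {h : Bool → ℕ} {b} → h false + h true ≤ 2 * b → ∃ λ c → h c ≤ b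
      choose {h} {b} le with h false ≤? b | h true ≤? b
      ... | yes h≤b | _       = false , h≤b
      ... | _       | yes h≤b = true , h≤b
      ... | no h≰b  | no h′≰b = contradiction le (<⇒≱ (subst (_< h false + h true)
              (cong (b +_) (sym (+-identityʳ b))) (+-mono-< (≰⇒> h≰b) (≰⇒> h′≰b))))

    light-obscurer-wins : [] ∉ S → 6 * potential S < 3 ^ L → ¬ SeekerWinsFor (r S) 2
    light-obscurer-wins []∉S bound =
      TwoCandidates.obscurer-wins (advance S) S ([] ∈_) (advance-detects S []∉S) Light
        (λ {U} {V} → light-safe {U} {V}) (λ {U} {V} → light-answer {U} {V}) {[]} {[]} z≤n
      where
      light-safe : ∀ {U V} → Light U V → [] ∉ U × [] ∉ V
      light-safe {U} {V} light =
        potential-∌[] (≤-<-trans (≤-trans (m≤m+n _ (potential V)) light) bound) ,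
        potential-∌[] (≤-<-trans (≤-trans (m≤n+m _ (potential U)) light) bound)

  potential-words : ∀ (V : List (Vec Bool L)) → potential (map toList V) ≡ length V * 2 ^ L
  potential-words []      = refl
  potential-words (v ∷ V) = cong₂ _+_ weight-word (potential-words V)
    where
    weight-word : weight (toList v) ≡ 2 ^ L
    weight-word rewrite Vec.length-toList v | n∸n≡0 L = *-identityʳ (2 ^ L)

-- With k = 3 + j, division by 3 leaves 4k · 16^(k - 1) < 81^(k - 1). For k = 2 this fails, as 128 >
-- 81.
potential-bound : ∀ j → 6 * ((3 + j) * 2 ^ suc (4 * (2 + j))) < 3 ^ suc (4 * (2 + j))
potential-bound j = begin-strict
  6 * ((3 + j) * (2 * 2 ^ (4 * (2 + j))))  ≡⟨ cong (λ z → 6 * ((3 + j) * (2 * z))) (^-*-assoc 2 4 (2 + j)) ⟨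
  6 * ((3 + j) * (2 * 16 ^ (2 + j)))       ≡⟨ rearrange (3 + j) (16 ^ (2 + j)) ⟩
  3 * (4 * (3 + j) * 16 ^ (2 + j))         <⟨ *-monoʳ-< 3 (go j) ⟩
  3 * 81 ^ (2 + j)                         ≡⟨ cong (3 *_) (^-*-assoc 3 4 (2 + j)) ⟩
  3 * 3 ^ (4 * (2 + j))                    ∎
  where
  open ≤-Reasoning
  rearrange : ∀ a b → 6 * (a * (2 * b)) ≡ 3 * (4 * a * b)
  rearrange = solve-∀
  -- The slack 716 + 260 j is 324 (3 + j) - 64 (4 + j).
  expand : ∀ j a → 4 * (4 + j) * (16 * a) + (716 + 260 * j) * a ≡ 81 * (4 * (3 + j) * a)
  expand = solve-∀
  go : ∀ j → 4 * (3 + j) * 16 ^ (2 + j) < 81 ^ (2 + j)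
  go zero    = toWitness {a? = 12 * 16 ^ 2 <? 81 ^ 2} _
  go (suc j) = begin-strict
    4 * (4 + j) * (16 * a)                       ≤⟨ m≤m+n _ _ ⟩
    4 * (4 + j) * (16 * a) + (716 + 260 * j) * a ≡⟨ expand j a ⟩
    81 * (4 * (3 + j) * a)                       <⟨ *-monoʳ-< 81 (go j) ⟩
    81 * 81 ^ (2 + j)                            ∎
    where a = 16 ^ (2 + j)

-- The case of two strings of length 5

∀Bool? : {P : Bool → Set} → (∀ b → Dec (P b)) → Dec (∀ b → P b)
∀Bool? P? = map′ (λ (f , t) → λ { false → f ; true → t }) (λ h → h false , h true)
                 (P? false ×-dec P? true)

∀Vec? : ∀ n {P : Vec Bool n → Set} → (∀ v → Dec (P v)) → Dec (∀ v → P v)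
∀Vec? zero    P? = map′ (λ p → λ { [] → p }) (λ h → h []) (P? [])
∀Vec? (suc n) P? = map′ (λ h → λ { (b ∷ v) → h b v }) (λ h b v → h (b ∷ v))
                        (∀Bool? λ b → ∀Vec? n λ v → P? (b ∷ v))

Window : Set
Window = Vec Bool 5

shift : Window → Bool → Window
shift w x = Vec.tail w Vec.∷ʳ x

-- The state is the last five bits, oldest first.  When the Obscurer is to choose the next bit,
-- she has also chosen the second and the fourth of them.
record Strategy : Set where
  field
    choice : Window → Bool
    reached : Window → Bool

open Strategy

-- Since `c xor not x` tests equality, `reached` records that her two bits in the window obeyed the
-- rule.
constant echo : Bool → Strategy
constant x = record
  { choice  = λ _ → x
  ; reached = λ { (_ ∷ c ∷ _ ∷ d ∷ _ ∷ []) → (c xor not x) ∧ (d xor not x) } }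
echo x = record
  { choice  = λ { (_ ∷ _ ∷ _ ∷ _ ∷ e ∷ []) → e xor x }
  ; reached = λ { (a ∷ c ∷ b ∷ d ∷ _ ∷ []) → (c xor not (a xor x)) ∧ (d xor not (b xor x)) } }

-- For `majority` only `d` is tested: `c` depended on bits that have left the window.
alternating majority : Strategy
alternating = record
  { choice  = λ { (_ ∷ _ ∷ _ ∷ d ∷ _ ∷ []) → not d }
  ; reached = λ { (_ ∷ c ∷ _ ∷ d ∷ _ ∷ []) → c xor d } }
majority = record
  { choice  = λ { (_ ∷ _ ∷ b ∷ d ∷ e ∷ []) → maj b d e }
  ; reached = λ { (a ∷ c ∷ b ∷ d ∷ _ ∷ []) → d xor not (maj a c b) } }
  where
  maj : Bool → Bool → Bool → Bool
  maj a b c = a ∧ b ∨ c ∧ (a ∨ b)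

strategies : List Strategy
strategies = constant false ∷ constant true ∷ echo false ∷ echo true ∷ alternating ∷ majority ∷ []

-- After her bit comes an arbitrary one, because the next answer is chosen for the sake of the other
-- candidate.
Closed : Strategy → Set
Closed σ = ∀ w → T (reached σ w) → ∀ y → T (reached σ (shift (shift w (choice σ w)) y))

strategies-closed : All Closed strategies
strategies-closed =
  toWitness {a? = all? (λ σ → ∀Vec? 5 λ w → T? _ →-dec ∀Bool? λ y → T? _) strategies} _

-- A reached window serves as a fictitious history before the first question.
strategies-inhabited : All (λ σ → ∃ λ w → T (reached σ w)) strategies
strategies-inhabited =
  (0# ∷ 0# ∷ 0# ∷ 0# ∷ 0# ∷ [] , _) ∷ (1# ∷ 1# ∷ 1# ∷ 1# ∷ 1# ∷ [] , _) ∷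
  (0# ∷ 0# ∷ 0# ∷ 0# ∷ 0# ∷ [] , _) ∷ (0# ∷ 1# ∷ 0# ∷ 1# ∷ 0# ∷ [] , _) ∷
  (0# ∷ 0# ∷ 0# ∷ 1# ∷ 0# ∷ [] , _) ∷ (0# ∷ 0# ∷ 0# ∷ 0# ∷ 0# ∷ [] , _) ∷ []
  where
  0# = false
  1# = true

-- A window occurs either when she is to choose or right after her choice; in the second case its
-- predecessor is `Vec.init s` behind an unknown bit `x`.
Avoids : Strategy → Window → Set
Avoids σ s = ¬ T (reached σ s) ×
             ∀ x → T (reached σ (x ∷ Vec.init s)) → choice σ (x ∷ Vec.init s) ≢ Vec.last s

-- A finite check of 32 · 32 pairs, done by evaluation.
strategies-avoid : ∀ s t → Any (λ σ → Avoids σ s × Avoids σ t) strategies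
strategies-avoid = toWitness {a? = ∀Vec? 5 λ s → ∀Vec? 5 λ t →
  any? (λ σ → avoids? σ s ×-dec avoids? σ t) strategies} _
  where
  avoids? : ∀ σ s → Dec (Avoids σ s)
  avoids? σ s = ¬? (T? _) ×-dec ∀Bool? λ x → T? _ →-dec ¬? (_ Bool.≟ _)

foldl-shift : ∀ w s → foldl shift w (toList s) ≡ s
foldl-shift (_ ∷ _ ∷ _ ∷ _ ∷ _ ∷ []) (_ ∷ _ ∷ _ ∷ _ ∷ _ ∷ []) = refl

Avoids⇒≢ : ∀ σ {s} → Avoids σ s → ∀ w → T (reached σ w) → w ≢ s × shift w (choice σ w) ≢ s
Avoids⇒≢ σ (unreached , unchosen) w@(a ∷ _ ∷ _ ∷ _ ∷ _ ∷ []) w-reached =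
  (λ { refl → unreached w-reached }) , (λ { refl → unchosen a w-reached refl })

module _ (σ : Strategy) (closed : Closed σ) {s t : Window}
  (avoids-s : Avoids σ s) (avoids-t : Avoids σ t) where

  -- `Waiting` carries its own safety because `reached` describes only windows before her choice.
  Choosing Waiting : Window → Set
  Choosing w = T (reached σ w)
  Waiting w  = ¬ (w ≡ s ⊎ w ≡ t) × ∀ y → Choosing (shift w y)

  choosing-safe : ∀ {w} → Choosing w → ¬ (w ≡ s ⊎ w ≡ t)
  choosing-safe {w} cw (inj₁ w≡s) = proj₁ (Avoids⇒≢ σ avoids-s w cw) w≡s
  choosing-safe {w} cw (inj₂ w≡t) = proj₁ (Avoids⇒≢ σ avoids-t w cw) w≡t

  choose : ∀ {w} → Choosing w → Waiting (shift w (choice σ w))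
  choose {w} cw = (λ { (inj₁ ≡s) → proj₂ (Avoids⇒≢ σ avoids-s w cw) ≡s
                     ; (inj₂ ≡t) → proj₂ (Avoids⇒≢ σ avoids-t w cw) ≡t }) , closed w cw

  Alternate : Window → Window → Set
  Alternate w w′ = (Choosing w × Waiting w′) ⊎ (Waiting w × Choosing w′)

  xor-cancelˡ : ∀ p x → p xor (p xor x) ≡ x
  xor-cancelˡ p x = trans (sym (Bool.xor-assoc p p x)) (cong (_xor x) (Bool.xor-same p))

  -- One answer sets both bits. It is solved for so that the choosing pattern gets its bit; the
  -- waiting one tolerates either bit, and the roles swap.
  alternate-answer : ∀ {w w′} → Alternate w w′ → ∀ p q →
                     ∃ λ c → Alternate (shift w (p xor c)) (shift w′ (q xor c))
  alternate-answer {w} (inj₁ (cw , _ , next)) p q = p xor choice σ w ,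
    inj₂ (subst (Waiting ∘ shift w) (sym (xor-cancelˡ p _)) (choose cw) , next _)
  alternate-answer {_} {w′} (inj₂ ((_ , next) , cw′)) p q = q xor choice σ w′ ,
    inj₁ (next _ , subst (Waiting ∘ shift w′) (sym (xor-cancelˡ q _)) (choose cw′))

  alternate-safe : ∀ {w w′} → Alternate w w′ → ¬ (w ≡ s ⊎ w ≡ t) × ¬ (w′ ≡ s ⊎ w′ ≡ t)
  alternate-safe (inj₁ (cw , safe , _)) = choosing-safe cw , safe
  alternate-safe (inj₂ ((safe , _) , cw)) = safe , choosing-safe cw

  windows-detected : ∀ {u} w → u ∈ toList s ∷ toList t ∷ [] →
                     foldl shift w u ≡ s ⊎ foldl shift w u ≡ t
  windows-detected w (here refl)         = inj₁ (foldl-shift w s)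
  windows-detected w (there (here refl)) = inj₂ (foldl-shift w t)

  strategy-obscurer-wins : ∀ {w} → Choosing w → ¬ SeekerWinsFor (r (toList s ∷ toList t ∷ [])) 2
  strategy-obscurer-wins cw =
    TwoCandidates.obscurer-wins shift _ (λ w → w ≡ s ⊎ w ≡ t) windows-detected
      -- Starting the second candidate one choice ahead puts the two out of phase.
      Alternate alternate-safe alternate-answer (inj₁ (cw , choose cw))

some-strategy-wins : ∀ {σs s t} → All Closed σs → All (λ σ → ∃ λ w → T (reached σ w)) σs →
  Any (λ σ → Avoids σ s × Avoids σ t) σs → ¬ SeekerWinsFor (r (toList s ∷ toList t ∷ [])) 2
some-strategy-wins {σ ∷ _} (closed ∷ _) ((_ , choosing) ∷ _) (here (avoids-s , avoids-t)) =
  strategy-obscurer-wins σ closed avoids-s avoids-t choosing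
some-strategy-wins (_ ∷ closed) (_ ∷ inhabited) (there avoid) = some-strategy-wins closed inhabited avoid

two-windows-obscurer-wins : ∀ s t → ¬ SeekerWinsFor (r (toList s ∷ toList t ∷ [])) 2
two-windows-obscurer-wins s t =
  some-strategy-wins strategies-closed strategies-inhabited (strategies-avoid s t)

-- Truncation to prefixes of length 4k - 3.

words-obscurer-wins : ∀ m → 1 ≤ m → (V : List (Vec Bool (suc (4 * m)))) → length V ≡ suc m →
                      ¬ SeekerWinsFor (r (map toList V)) 2
-- Here m = k - 1, so this is the case k = 2.
words-obscurer-wins 1             _ (s ∷ t ∷ []) refl = two-windows-obscurer-wins s t
words-obscurer-wins (suc (suc j)) _ V            len  =
  light-obscurer-wins (map toList V) []∉V (subst (λ φ → 6 * φ < 3 ^ L) (sym potential≡) (potential-bound j))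
  where
  L = suc (4 * (2 + j))
  open Potential L
  potential≡ : potential (map toList V) ≡ (3 + j) * 2 ^ L
  potential≡ = trans (potential-words V) (cong (_* 2 ^ L) len)
  []∉V : [] ∉ map toList V
  []∉V []∈V with ∈-map⁻ toList []∈V
  ... | _ ∷ _ , _ , ()

prefix : ∀ L s → L ≤ length s → ∃ λ (v : Vec Bool L) → ∃ λ rest → toList v ++ rest ≡ s
prefix zero    s       _        = [] , s , refl
prefix (suc L) (x ∷ s) (s≤s L≤) = let v , rest , eq = prefix L s L≤ in x ∷ v , rest , cong (x ∷_) eq

-- Whatever contains a string contains its prefix. Coinciding prefixes stay repeated in `V`, which
-- preserves the count.
prefixes : ∀ {L S} → All (λ s → L ≤ length s) S →
           ∃ λ (V : List (Vec Bool L)) → length V ≡ length S × (∀ {w} → r (map toList V) w → r S w)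
prefixes []                  = [] , refl , λ _ ()
prefixes {L} {s ∷ S} (L≤s ∷ L≤S) with prefix L s L≤s | prefixes L≤S
... | v , rest , refl | V , len , r⊆ = v ∷ V , cong suc len , λ where
  rV (here refl) (xs , ys , eq) →
    rV (here refl) (xs , rest ++ ys , trans (cong (xs ++_) (sym (++-assoc (toList v) rest ys))) eq)
  rV (there s∈S) → r⊆ (rV ∘ there) s∈S

theorem10 : (S : List BinStr) (k : ℕ) → Unique S → length S ≡ k → 2 ≤ k →
    All (λ s → s ≢ []) S → SeekerWinsGame (r S) →
    Any (λ s → length s ≤ 4 * k ∸ 4) S
theorem10 S (suc m) _ len (s≤s 1≤m) _ win with any? (λ s → length s ≤? 4 * suc m ∸ 4) S
... | yes short = short
... | no ¬short =
  let V , V-len , r⊆ = prefixes (All.map (λ {s} → long s) (¬Any⇒All¬ S ¬short))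
  in contradiction (SeekerWins-antitone r⊆ (win 2 (s≤s z≤n)))
                   (words-obscurer-wins m 1≤m V (trans V-len len))
  where
  -- As `4 * suc m ∸ 4` is `4 * m`, a longer string has a prefix of length `suc (4 * m)`.
  long : ∀ (s : BinStr) → ¬ length s ≤ 4 * suc m ∸ 4 → 4 * m < length s
  long s ≰ = subst (_< length s) (trans (cong (_∸ 4) (*-suc 4 m)) (m+n∸m≡n 4 (4 * m))) (≰⇒> ≰)
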